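{- Any $r$-round algorithm in the CONGESTED CLIQUE model on $n$ nodes can be compiled into an equivalent algorithm that is resilient against $\Theta(n)$-mobile byzantine adversaries and uses $\widetilde O(r)$ rounds.
   Context: CONGESTED CLIQUE model: $n$ nodes, synchronous rounds; in each round every ordered pair of nodes can exchange a message of $O(\log n)$ bits (the communication graph is the complete graph on $n$ nodes). $\widetilde O(\cdot)$ hides factors poly-logarithmic in $n$. An $f$-mobile byzantine adversary is computationally unbounded, knows the communication graph and the algorithm, and sees the messages sent over all edges in each round, but does not know the nodes' private randomness. In each round $i$ it chooses a set $F_i$ of at most $f$ edges (possibly $F_i\ne F_j$ for $i\neq j$) and may replace arbitrarily the messages sent over the edges of $F_i$, in both directions. The nodes do not know the sets $F_i$. "Resilient against $\Theta(n)$-mobile adversaries" means that for some $f=\Theta(n)$ (i.e., $f\ge cn$ for an absolute constant $c>0$) the correctness holds in the presence of any $f$-mobile byzantine adversary. Equivalent means giving the same output (distribution) as the fault-free execution of the original algorithm. Compiled algorithms are randomized, and as usual their correctness is meant with high probability, i.e., with probability at least $1-1/n^{c'}$ for any desired constant $c'\ge 1$. -}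

module Defs where

open import Data.Bool using (Bool; true; false; if_then_else_)
open import Data.Fin using (Fin; _≟_; _<_)
open import Data.Integer using (+_)
open import Data.List as List using (List; []; _∷_; length; filterᵇ; cartesianProductWith)
open import Data.List.Relation.Unary.Any using (any?)
open import Data.Nat as ℕ using (ℕ; zero; suc; NonZero)
open import Data.Nat.Logarithm using (⌈log₂_⌉)
open import Data.Nat.Properties using (m^n≢0)
open import Data.Product using (∃-syntax; _×_)
open import Data.Rational using (ℚ; _/_; _-_; ∣_∣; _≤_)
open import Data.Vec as Vec using (Vec; lookup; tabulate; transpose)
open import Function using (_∘_)
open import Relation.Nullary using (does; _×-dec_; _⊎-dec_)

IsΘn : (ℕ → ℕ) → Set
IsΘn f = ∃[ a ] ∃[ b ] ∃[ n₀ ]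
  (∀ n → n₀ ℕ.≤ n → (n ℕ.≤ a ℕ.* f n) × (f n ℕ.≤ b ℕ.* n))

-- The "1 +" only avoids a vanishing factor at n = 1.
polylog : ℕ → ℕ → ℕ
polylog k n = (1 ℕ.+ ⌈log₂ n ⌉) ℕ.^ k

Message : ℕ → Set
Message w = Vec Bool w

-- Entry (u , v) of a traffic matrix is the message from u to v in one round.
-- The diagonal is a message of a node to itself; it carries no information
-- between nodes, and the adversary below cannot touch it.
Traffic : ℕ → ℕ → Set
Traffic n w = Vec (Vec (Message w) n) n

-- All private coins of a node are drawn at the start; the node is free to
-- leave any of them unused (hence unseen by others) until a later round.
-- A node that needs the round number keeps a counter in its state.
record Algorithm (n w : ℕ) (I O : Set) : Set₁ where
  field
    rounds  : ℕ
    coins   : ℕ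
    State   : Set
    init    : Fin n → I → Vec Bool coins → State
    send    : Fin n → State → Vec (Message w) n
    receive : Fin n → State → Vec (Message w) n → State
    output  : Fin n → State → O

-- What is delivered in a round, given the messages sent in it and those sent in
-- the earlier rounds (latest first), all as they were before tampering.
Channel : ℕ → ℕ → Set
Channel n w = Traffic n w → List (Traffic n w) → Traffic n w

faultFree : ∀ {n w} → Channel n w
faultFree sent _ = sent

-- An undirected edge of the complete graph, named by its ordered endpoints.
record Edge (n : ℕ) : Set where
  field
    lo hi : Fin n
    lo<hi : lo < hi

record Attack (n w f : ℕ) : Set where
  field
    edges   : List (Edge n)
    atMost  : length edges ℕ.≤ f
    forged  : Traffic n w

-- A strategy sees the messages sent in the present round and in all earlier
-- ones.  It is a deterministic function of them: a guarantee against every such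
-- strategy extends to randomized ones by averaging.  The tampered messages
-- need not be recorded, as the strategy can recompute them.
Adversary : ℕ → ℕ → ℕ → Set
Adversary n w f = Traffic n w → List (Traffic n w) → Attack n w f

controls : ∀ {n} → List (Edge n) → Fin n → Fin n → Bool
controls F u v = does (any? joins? F)
  where
  open Edge
  joins? = λ e → ((lo e ≟ u) ×-dec (hi e ≟ v)) ⊎-dec ((lo e ≟ v) ×-dec (hi e ≟ u))

tampered : ∀ {n w f} → Adversary n w f → Channel n w
tampered adv sent past = tabulate λ u → tabulate λ v →
  if controls edges u v then lookup (lookup forged u) v
                        else lookup (lookup sent u) v
  where open Attack (adv sent past)

module _ {n w : ℕ} {I O : Set} (A : Algorithm n w I O) where
  open Algorithm A

  execute : Channel n w → ℕ → List (Traffic n w) → Vec State n → Vec State n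
  execute ch zero    past states = states
  execute ch (suc k) past states =
    execute ch k (sent ∷ past)
      (tabulate λ v → receive v (lookup states v) (lookup inboxes v))
    where
    sent    = tabulate λ u → send u (lookup states u)
    inboxes = transpose (ch sent past)

  run : Channel n w → Vec I n → Vec (Vec Bool coins) n → Vec O n
  run ch inputs tapes =
    tabulate λ v → output v (lookup final v)
    where
    final = execute ch rounds []
      (tabulate λ v → init v (lookup inputs v) (lookup tapes v))

vectors : ∀ {A : Set} → List A → ∀ n → List (Vec A n)
vectors xs zero    = Vec.[] ∷ []
vectors xs (suc n) = cartesianProductWith Vec._∷_ xs (vectors xs n)

allTapes : ∀ n ρ → List (Vec (Vec Bool ρ) n)
allTapes n ρ = vectors (vectors (false ∷ true ∷ []) ρ) n

-- Probability over independent uniform coins, ρ for each of n nodes; the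
-- denominator is the length of allTapes n ρ.
Pr : ∀ {n ρ} → (Vec (Vec Bool ρ) n → Bool) → ℚ
Pr {n} {ρ} E =
  _/_ (+ length (filterᵇ E (allTapes n ρ))) (2 ℕ.^ (ρ ℕ.* n)) {{m^n≢0 2 (ρ ℕ.* n)}}

-- The probability that the joint output of all nodes lies in E.
outputPr : ∀ {n w I O} → Algorithm n w I O → Channel n w → Vec I n → (Vec O n → Bool) → ℚ
outputPr A ch inputs E = Pr (E ∘ run A ch inputs)

-- On every input and under every f-mobile adversary, the joint output
-- distribution of A′ is within total variation distance ε of that of the
-- fault-free A.  Equivalently, the two outputs can be coupled so as to agree
-- with probability at least 1 - ε; for deterministic A this says that A′
-- outputs the result of A with probability at least 1 - ε.
ResilientlyEquivalent : ∀ {n w w′ I O} → ℕ → ℚ → Algorithm n w I O → Algorithm n w′ I O → Set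
ResilientlyEquivalent {n} {w} {w′} {I} {O} f ε A A′ =
  (inputs : Vec I n) (adv : Adversary n w′ f) (E : Vec O n → Bool) →
  ∣ outputPr A′ (tampered adv) inputs E - outputPr A faultFree inputs E ∣ ≤ ε

1/_^_ : (n c : ℕ) .{{_ : NonZero n}} → ℚ
1/ n ^ c = _/_ (+ 1) (n ℕ.^ c) {{m^n≢0 n c}}

{-# OPTIONS --safe #-}

-- One fault-free round can be simulated, with certainty, in three rounds.  First
-- all messages are sent directly; an adversary on f edges spoils at most 2f of
-- them.  Let E be the matrix (received − sent) over a finite field with O(log n)
-- bit elements, and let the syndrome of E have the n coordinates
-- ∑ E u v / (α u v + β x), with all α u v and β x distinct.  It is linear in E, and
-- a nonzero E with s nonzero entries has a syndrome with fewer than s zeros, as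
-- these are roots of a polynomial of degree less than s.  In the second round
-- every node v sends to every x its share of coordinate x, namely what column v
-- (received by v) and row v (sent by v) contribute; x adds up the shares and
-- announces the sum in the third round.  At most 2f coordinates are spoiled by
-- each of these rounds, so for 12f < n every node can still determine E.
module Submission where

open import Defs
open import Algebra.Bundles using (CommutativeRing)
open import Algebra.Core using (Op₁; Op₂)
open import Algebra.Structures using (IsCommutativeRing)
open import Algebra.Solver.Ring.AlmostCommutativeRing using (AlmostCommutativeRing; fromCommutativeRing; _-Raw-AlmostCommutative⟶_)
import Algebra.Solver.Ring as RingSolver
import Algebra.Properties.Semiring.Sum as SemiringSum
open import Data.Bool as Bool using (Bool; true; false; if_then_else_)
open import Data.Bool.Properties using (xor-∧-commutativeRing; T?)
open import Data.Fin as Fin using (Fin; zero; suc; combine; quotient; remainder; inject≤)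
import Data.Fin.Properties as Fin
open import Data.Fin.Properties using (2↔Bool; combine-remQuot; inject≤-injective)
open import Data.Fin.Subset.Properties using (anySubset?)
import Data.Integer as ℤ
open import Data.List as List using (List; []; _∷_; length; filter)
open import Data.List.Membership.Propositional using (_∈_)
open import Data.List.Membership.Propositional.Properties using (∈-map⁺; ∈-map⁻; ∈-filter⁺; ∈-filter⁻; ∈-++⁺ˡ; ∈-++⁺ʳ)
import Data.List.Membership.DecPropositional as DecMembership
open import Data.List.Properties using (length-filter; length-map; length-++; filter-≐)
open import Data.List.Relation.Unary.Any using (Any; any?; here; there)
import Data.Maybe as Maybe
open import Data.Nat as ℕ using (ℕ; zero; suc; z≤n; s≤s; NonZero; _≤_)
open import Data.Nat.DivMod using (_/_; _%_; m≡m%n+[m/n]*n; m/n*n≤m; m%n<n; m/n≤m; m≥n⇒m/n>0)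
open import Data.Nat.Induction using (<-rec)
open import Data.Nat.Logarithm using (⌈log₂_⌉; ⌈log₂⌈n/2⌉⌉≡⌈log₂n⌉∸1)
import Data.Nat.Properties as ℕ
import Data.Nat.Solver as ℕSolver
open import Data.Product using (Σ; ∃; ∃-syntax; _×_; _,_; proj₁; proj₂)
open import Data.Product.Properties using (≡-dec)
open import Data.Rational as ℚ using (0ℚ)
import Data.Rational.Properties as ℚ
open import Data.Sum using (_⊎_; inj₁; inj₂; [_,_]′)
open import Data.Vec as Vec using (Vec; []; _∷_; take; drop; _++_; lookup; tabulate; transpose; replicate; truncate; padRight)
import Data.Vec.Properties as Vec
open import Function using (id; _∘_; Injective; _↔_; Inverse; mk↔ₛ′)
open import Level using (0ℓ)
open import Relation.Binary using (Decidable)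
open import Relation.Binary.PropositionalEquality using (_≡_; _≢_; refl; sym; trans; cong; cong₂; subst; isMagma; module ≡-Reasoning)
open import Relation.Nullary using (Dec; yes; no; does; ¬?; contradiction; _×-dec_; _⊎-dec_)
open import Relation.Nullary.Decidable using (dec⇒maybe; map′)
open import Relation.Unary using () renaming (Decidable to Decidable₁)

-- Finite fields of characteristic two

-- Negation is the identity, so the characteristic is two.  The last two fields
-- say that x² + x + θ is irreducible.
record BinaryField : Set₁ where
  infixl 6 _+_
  infixl 7 _*_
  field
    Carrier           : Set
    _+_ _*_           : Op₂ Carrier
    0# 1#             : Carrier
    isCommutativeRing : IsCommutativeRing _≡_ _+_ _*_ id 0# 1#
    inv               : Op₁ Carrier
    *-inverseʳ        : ∀ {x} → x ≢ 0# → x * inv x ≡ 1#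
    width             : ℕ
    coding            : Carrier ↔ Vec Bool width
    θ                 : Carrier
    θ-irreducible     : ∀ x → x * x + x ≢ θ

  commutativeRing : CommutativeRing 0ℓ 0ℓ
  commutativeRing = record { isCommutativeRing = isCommutativeRing }

  open CommutativeRing commutativeRing public
    using (semiring; +-identityˡ; +-identityʳ; +-assoc; +-comm; *-identityˡ; *-identityʳ; *-comm; *-assoc; distribʳ; zeroˡ; zeroʳ; -‿inverseʳ)
  open SemiringSum semiring public
    using (sum; sum-syntax; sum-cong-≗; ∑-distrib-+; ∑-comm; *-distribʳ-sum)

  open Inverse coding public using () renaming (to to encode; from to decode)

  decode-encode : ∀ x → decode (encode x) ≡ x
  decode-encode = Inverse.strictlyInverseʳ coding

  encode-decode : ∀ bs → encode (decode bs) ≡ bs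
  encode-decode = Inverse.strictlyInverseˡ coding

  infix 4 _≟_
  _≟_ : Decidable (_≡_ {A = Carrier})
  x ≟ y = map′ (λ eq → trans (sym (decode-encode x)) (trans (cong decode eq) (decode-encode y)))
               (cong encode) (Vec.≡-dec Bool._≟_ (encode x) (encode y))

  private
    almostCommutativeRing : AlmostCommutativeRing 0ℓ 0ℓ
    almostCommutativeRing = fromCommutativeRing commutativeRing

    fromBool : Bool → Carrier
    fromBool false = 0#
    fromBool true  = 1#

    fromBool-homomorphism :
      CommutativeRing.rawRing xor-∧-commutativeRing -Raw-AlmostCommutative⟶ almostCommutativeRing
    fromBool-homomorphism = record
      { ⟦_⟧    = fromBool
      ; +-homo = λ { false y → sym (+-identityˡ _)
                   ; true false → sym (+-identityʳ _)
                   ; true true → sym (-‿inverseʳ 1#) }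
      ; *-homo = λ { false y → sym (zeroˡ _) ; true y → sym (*-identityˡ _) }
      ; -‿homo = λ _ → refl
      ; 0-homo = refl
      ; 1-homo = refl
      }

  -- With coefficients in the two-element field, the solver knows that x + x = 0.
  open RingSolver (CommutativeRing.rawRing xor-∧-commutativeRing) almostCommutativeRing
    fromBool-homomorphism (λ x y → Maybe.map (cong fromBool) (dec⇒maybe (x Bool.≟ y))) public
    using (solve; con; _:+_; _:*_; _:=_)

  x+x≡0 : ∀ x → x + x ≡ 0#
  x+x≡0 = -‿inverseʳ

  x+y≡0⇒x≡y : ∀ {x y} → x + y ≡ 0# → x ≡ y
  x+y≡0⇒x≡y {x} {y} eq = begin
    x            ≡⟨ solve 2 (λ x y → x := (x :+ y) :+ y) refl x y ⟩
    (x + y) + y  ≡⟨ cong (_+ y) eq ⟩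
    0# + y       ≡⟨ +-identityˡ y ⟩
    y            ∎
    where open ≡-Reasoning

  *-cancel-zero : ∀ {x y} → x ≢ 0# → x * y ≡ 0# → y ≡ 0#
  *-cancel-zero {x} {y} x≢0 eq = begin
    y                ≡⟨ *-identityˡ y ⟨
    1# * y           ≡⟨ cong (_* y) (*-inverseʳ x≢0) ⟨
    (x * inv x) * y  ≡⟨ solve 3 (λ x i y → (x :* i) :* y := i :* (x :* y)) refl x (inv x) y ⟩
    inv x * (x * y)  ≡⟨ cong (inv x *_) eq ⟩
    inv x * 0#       ≡⟨ zeroʳ _ ⟩
    0#               ∎
    where open ≡-Reasoning

𝔽₂ : BinaryField
𝔽₂ = record
  { Carrier = Bool
  ; isCommutativeRing = CommutativeRing.isCommutativeRing xor-∧-commutativeRing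
  ; inv = id
  ; *-inverseʳ = λ { {false} x≢0 → contradiction refl x≢0 ; {true} _ → refl }
  ; width = 1
  ; coding = mk↔ₛ′ (λ b → b ∷ []) Vec.head (λ { (b ∷ []) → refl }) (λ _ → refl)
  ; θ = true
  ; θ-irreducible = λ { false () ; true () }
  }

-- F[x] / (x² + x + θ), where (p , q) stands for p + q x.  If p + q x were a
-- root of z² + z = θ x, comparing coefficients of x would give q² + q = θ.
quadraticExtension : BinaryField → BinaryField
quadraticExtension F = record
  { Carrier = K
  ; _+_ = _⊕_
  ; _*_ = _⊗_
  ; 0# = 0# , 0#
  ; 1# = 1# , 0#
  ; isCommutativeRing = record
    { isRing = record
      { +-isAbelianGroup = record
        { isGroup = record
          { isMonoid = record
            { isSemigroup = record
              { isMagma = isMagma _⊕_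
              ; assoc = λ (a , b) (c , d) (e , f) → cong₂ _,_ (+-assoc a c e) (+-assoc b d f) }
            ; identity = (λ (a , b) → cong₂ _,_ (+-identityˡ a) (+-identityˡ b))
                       , (λ (a , b) → cong₂ _,_ (+-identityʳ a) (+-identityʳ b)) }
          ; inverse = (λ (a , b) → cong₂ _,_ (x+x≡0 a) (x+x≡0 b))
                    , (λ (a , b) → cong₂ _,_ (x+x≡0 a) (x+x≡0 b))
          ; ⁻¹-cong = id }
        ; comm = λ (a , b) (c , d) → cong₂ _,_ (+-comm a c) (+-comm b d) }
      ; *-cong = cong₂ _⊗_
      ; *-assoc = λ (a , b) (c , d) (e , f) → cong₂ _,_
          (solve 7 (λ a b c d e f t →
             (a :* c :+ b :* d :* t) :* e :+ (a :* d :+ b :* c :+ b :* d) :* f :* t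
             := a :* (c :* e :+ d :* f :* t) :+ b :* (c :* f :+ d :* e :+ d :* f) :* t) refl a b c d e f θ)
          (solve 7 (λ a b c d e f t →
             (a :* c :+ b :* d :* t) :* f :+ (a :* d :+ b :* c :+ b :* d) :* e :+ (a :* d :+ b :* c :+ b :* d) :* f
             := a :* (c :* f :+ d :* e :+ d :* f) :+ b :* (c :* e :+ d :* f :* t) :+ b :* (c :* f :+ d :* e :+ d :* f))
             refl a b c d e f θ)
      ; *-identity = (λ z → trans (⊗-comm _ z) (⊗-identityʳ z)) , ⊗-identityʳ
      ; distrib = (λ x y z → trans (⊗-comm x (y ⊕ z))
                               (trans (⊗-distribʳ x y z) (cong₂ _⊕_ (⊗-comm y x) (⊗-comm z x))))
                , ⊗-distribʳ }
    ; *-comm = ⊗-comm }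
  ; inv = inverse
  ; *-inverseʳ = ⊗-inverseʳ
  ; width = width ℕ.+ width
  ; coding = mk↔ₛ′ (λ (p , q) → encode p ++ encode q)
      (λ bs → decode (take width bs) , decode (drop width bs))
      (λ bs → trans (cong₂ _++_ (encode-decode _) (encode-decode _)) (Vec.take++drop≡id width bs))
      (λ (p , q) →
        let take≡ , drop≡ = Vec.++-injective (take width (encode p ++ encode q)) (encode p)
                              (Vec.take++drop≡id width _)
        in cong₂ _,_ (trans (cong decode take≡) (decode-encode p))
                     (trans (cong decode drop≡) (decode-encode q)))
  ; θ = 0# , θ
  ; θ-irreducible = λ (p , q) eq → θ-irreducible q (begin
      q * q + q                            ≡⟨ solve 2 (λ p q → q :* q :+ q := (p :* q :+ q :* p :+ q :* q) :+ q) refl p q ⟩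
      (p * q + q * p + q * q) + q          ≡⟨ cong proj₂ eq ⟩
      θ                                    ∎)
  }
  where
  open BinaryField F
  open ≡-Reasoning

  K : Set
  K = Carrier × Carrier

  _⊕_ _⊗_ : Op₂ K
  (a , b) ⊕ (c , d) = a + c , b + d
  (a , b) ⊗ (c , d) = a * c + b * d * θ , a * d + b * c + b * d

  ⊗-comm : ∀ x y → x ⊗ y ≡ y ⊗ x
  ⊗-comm (a , b) (c , d) = cong₂ _,_
    (solve 5 (λ a b c d t → a :* c :+ b :* d :* t := c :* a :+ d :* b :* t) refl a b c d θ)
    (solve 4 (λ a b c d → a :* d :+ b :* c :+ b :* d := c :* b :+ d :* a :+ d :* b) refl a b c d)

  ⊗-identityʳ : ∀ z → z ⊗ (1# , 0#) ≡ z
  ⊗-identityʳ (p , q) = cong₂ _,_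
    (solve 3 (λ p q t → p :* con true :+ q :* con false :* t := p) refl p q θ)
    (solve 2 (λ p q → p :* con false :+ q :* con true :+ q :* con false := q) refl p q)

  ⊗-distribʳ : ∀ x y z → (y ⊕ z) ⊗ x ≡ (y ⊗ x) ⊕ (z ⊗ x)
  ⊗-distribʳ (a , b) (c , d) (e , f) = cong₂ _,_
    (solve 7 (λ a b c d e f t →
       (c :+ e) :* a :+ (d :+ f) :* b :* t := (c :* a :+ d :* b :* t) :+ (e :* a :+ f :* b :* t))
       refl a b c d e f θ)
    (solve 6 (λ a b c d e f →
       (c :+ e) :* b :+ (d :+ f) :* a :+ (d :+ f) :* b
       := (c :* b :+ d :* a :+ d :* b) :+ (e :* b :+ f :* a :+ f :* b))
       refl a b c d e f)

  -- The field norm: the other root of x² + x + θ is x + 1, so the conjugate of `(p , q)` is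
  -- `(p + q , q)`, and `norm` is the product of the two. Dividing the conjugate by it gives the
  -- inverse.
  norm : K → Carrier
  norm (p , q) = p * (p + q) + q * q * θ

  inverse : Op₁ K
  inverse z@(p , q) = (p + q) * inv (norm z) , q * inv (norm z)

  -- For q ≠ 0 the norm divided by q² is t² + t + θ at t = p / q, which irreducibility keeps away
  -- from zero. For q = 0 the norm is p².
  norm≡0⇒≡0 : ∀ z → norm z ≡ 0# → z ≡ (0# , 0#)
  norm≡0⇒≡0 (p , q) N≡0 with q ≟ 0#
  ... | no q≢0 = contradiction (sym (x+y≡0⇒x≡y θ+t²+t≡0)) (θ-irreducible t)
    where
    i t : Carrier
    i = inv q
    t = p * i
    θ+t²+t≡0 : θ + (t * t + t) ≡ 0#
    θ+t²+t≡0 = begin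
      θ + (t * t + t)
        ≡⟨ solve 2 (λ t a → a :+ (t :* t :+ t) := a :* con true :* con true :+ (t :* t :+ t :* con true)) refl t θ ⟩
      θ * 1# * 1# + (t * t + t * 1#)
        ≡⟨ cong (λ u → θ * u * u + (t * t + t * u)) (*-inverseʳ q≢0) ⟨
      θ * (q * i) * (q * i) + (t * t + t * (q * i))
        ≡⟨ solve 4 (λ p q i a → a :* (q :* i) :* (q :* i) :+ ((p :* i) :* (p :* i) :+ (p :* i) :* (q :* i))
                     := i :* i :* (p :* (p :+ q) :+ q :* q :* a)) refl p q i θ ⟩
      i * i * norm (p , q)
        ≡⟨ cong (i * i *_) N≡0 ⟩
      i * i * 0#
        ≡⟨ zeroʳ _ ⟩
      0#
        ∎
  ... | yes refl with p ≟ 0#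
  ...   | yes refl = refl
  ...   | no p≢0 = contradiction (*-cancel-zero p≢0 (begin
            p * p  ≡⟨ solve 2 (λ p a → p :* p := p :* (p :+ con false) :+ con false :* con false :* a) refl p θ ⟩
            norm (p , 0#)  ≡⟨ N≡0 ⟩
            0# ∎)) p≢0

  ⊗-inverseʳ : ∀ {z} → z ≢ (0# , 0#) → z ⊗ inverse z ≡ (1# , 0#)
  ⊗-inverseʳ {z@(p , q)} z≢0 = cong₂ _,_
    (trans (solve 4 (λ p q i a → p :* ((p :+ q) :* i) :+ q :* (q :* i) :* a := (p :* (p :+ q) :+ q :* q :* a) :* i)
              refl p q (inv (norm z)) θ)
           (*-inverseʳ (z≢0 ∘ norm≡0⇒≡0 z)))
    (solve 3 (λ p q i → p :* (q :* i) :+ q :* ((p :+ q) :* i) :+ q :* (q :* i) := con false)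
       refl p q (inv (norm z)))

-- Each extension supplies the irreducible polynomial for the next one, so no search for such
-- polynomials is needed. Level k has 2 ^ (2 ^ k) elements.
binaryTower : ℕ → BinaryField
binaryTower zero    = 𝔽₂
binaryTower (suc k) = quadraticExtension (binaryTower k)

width-binaryTower : ∀ k → BinaryField.width (binaryTower k) ≡ 2 ℕ.^ k
width-binaryTower zero    = refl
width-binaryTower (suc k) = cong₂ ℕ._+_ (width-binaryTower k) (trans (width-binaryTower k) (sym (ℕ.+-identityʳ _)))

-- Polynomial functions, their degrees and roots

module Polynomials (F : BinaryField) where
  open BinaryField F

  -- A polynomial is kept as a function together with a Horner scheme of d coefficients, so
  -- identities between polynomials are pointwise and fall to the ring solver.
  data Degree< : ℕ → (Carrier → Carrier) → Set where
    null   : ∀ {f} → (∀ x → f x ≡ 0#) → Degree< 0 f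
    horner : ∀ {d f g} c → Degree< d g → (∀ x → f x ≡ c + x * g x) → Degree< (suc d) f

  degree<-resp : ∀ {d f g} → (∀ x → g x ≡ f x) → Degree< d f → Degree< d g
  degree<-resp g≗f (null f≗0)     = null λ x → trans (g≗f x) (f≗0 x)
  degree<-resp g≗f (horner c p e) = horner c p λ x → trans (g≗f x) (e x)

  degree<-0 : ∀ {d f} → (∀ x → f x ≡ 0#) → Degree< d f
  degree<-0 {zero}  f≗0 = null f≗0
  degree<-0 {suc d} f≗0 = horner 0# (degree<-0 {d} λ _ → refl) λ x →
    trans (f≗0 x) (solve 1 (λ x → con false := con false :+ x :* con false) refl x)

  degree<-suc : ∀ {d f} → Degree< d f → Degree< (suc d) f
  degree<-suc (null f≗0)     = degree<-0 f≗0
  degree<-suc (horner c p e) = horner c (degree<-suc p) e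

  degree<-mono : ∀ {d e f} → d ℕ.≤ e → Degree< d f → Degree< e f
  degree<-mono {e = zero}  z≤n       p              = p
  degree<-mono {e = suc e} z≤n       (null f≗0)     = degree<-0 f≗0
  degree<-mono             (s≤s d≤e) (horner c p e) = horner c (degree<-mono d≤e p) e

  degree<-+ : ∀ {d f g} → Degree< d f → Degree< d g → Degree< d (λ x → f x + g x)
  degree<-+ (null f≗0) (null g≗0) = null λ x → trans (cong₂ _+_ (f≗0 x) (g≗0 x)) (+-identityˡ 0#)
  degree<-+ {f = f} {g} (horner {g = f′} c p e) (horner {g = g′} c′ p′ e′) =
    horner (c + c′) (degree<-+ p p′) λ x → trans (cong₂ _+_ (e x) (e′ x))
      (solve 5 (λ c c′ x f g → (c :+ x :* f) :+ (c′ :+ x :* g) := (c :+ c′) :+ x :* (f :+ g)) refl c c′ x (f′ x) (g′ x))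

  degree<-scale : ∀ {d f} a → Degree< d f → Degree< d (λ x → a * f x)
  degree<-scale a (null f≗0) = null λ x → trans (cong (a *_) (f≗0 x)) (zeroʳ a)
  degree<-scale a (horner {g = g} c p e) = horner (a * c) (degree<-scale a p) λ x →
    trans (cong (a *_) (e x))
      (solve 4 (λ a c x g → a :* (c :+ x :* g) := a :* c :+ x :* (a :* g)) refl a c x (g x))

  degree<-linear : ∀ {d f} r → Degree< d f → Degree< (suc d) (λ x → (x + r) * f x)
  degree<-linear {f = f} r p =
    degree<-resp (λ x → solve 3 (λ x r f → (x :+ r) :* f := (con false :+ x :* f) :+ r :* f) refl x r (f x))
      (degree<-+ (horner 0# p λ _ → refl) (degree<-suc (degree<-scale r p)))

  degree<-sum : ∀ {d n} (f : Fin n → Carrier → Carrier) →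
                (∀ i → Degree< d (f i)) → Degree< d (λ x → ∑[ i < n ] f i x)
  degree<-sum {n = zero}  f p = degree<-0 λ _ → refl
  degree<-sum {n = suc n} f p = degree<-+ (p zero) (degree<-sum (f ∘ suc) (p ∘ suc))

  -- Synthetic division by x - r, written x + r in characteristic two. If the Horner tail g is g r +
  -- (x + r) h, then the quotient of f is g r + x h.
  degree<-divide : ∀ {d f} r → Degree< (suc d) f →
                   ∃[ g ] Degree< d g × (∀ x → f x ≡ f r + (x + r) * g x)
  degree<-divide {f = f} r (horner c (null {g} g≗0) e) = (λ _ → 0#) , degree<-0 (λ _ → refl) , λ x → begin
    f x                     ≡⟨ constant x ⟩
    c                       ≡⟨ constant r ⟨
    f r                     ≡⟨ solve 3 (λ y x r → y := y :+ (x :+ r) :* con false) refl (f r) x r ⟩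
    f r + (x + r) * 0#      ∎
    where
    open ≡-Reasoning
    constant : ∀ x → f x ≡ c
    constant x = begin
      f x        ≡⟨ e x ⟩
      c + x * g x ≡⟨ cong (λ y → c + x * y) (g≗0 x) ⟩
      c + x * 0# ≡⟨ solve 2 (λ c x → c :+ x :* con false := c) refl c x ⟩
      c          ∎
  degree<-divide {f = f} r (horner {g = g} c p@(horner _ _ _) e) with degree<-divide r p
  ... | h , q , g≗ = (λ x → g r + x * h x) , horner (g r) q (λ _ → refl) , λ x → begin
    f x                                           ≡⟨ e x ⟩
    c + x * g x                                   ≡⟨ cong (λ y → c + x * y) (g≗ x) ⟩
    c + x * (g r + (x + r) * h x)
      ≡⟨ solve 5 (λ c x r y h → c :+ x :* (y :+ (x :+ r) :* h) := (c :+ r :* y) :+ (x :+ r) :* (y :+ x :* h)) refl c x r (g r) (h x) ⟩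
    (c + r * g r) + (x + r) * (g r + x * h x)     ≡⟨ cong (_+ _) (e r) ⟨
    f r + (x + r) * (g r + x * h x)               ∎
    where open ≡-Reasoning

  -- Dividing by the linear factor of one root leaves the others as roots of the quotient, because
  -- they are distinct from it. After d divisions nothing but the zero function is left.
  degree<-roots : ∀ {d f} (r : Fin d → Carrier) → Injective _≡_ _≡_ r → Degree< d f →
                  (∀ i → f (r i) ≡ 0#) → ∀ x → f x ≡ 0#
  degree<-roots {zero} r r-inj (null f≗0) _ = f≗0
  degree<-roots {suc d} {f} r r-inj p f∘r≗0 x with degree<-divide (r zero) p
  ... | g , q , f≗ = trans (factored x)
    (trans (cong ((x + r zero) *_) (degree<-roots (r ∘ suc) (Fin.suc-injective ∘ r-inj) q g∘r≗0 x)) (zeroʳ _))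
    where
    factored : ∀ x → f x ≡ (x + r zero) * g x
    factored x = trans (f≗ x) (trans (cong (_+ _) (f∘r≗0 zero)) (+-identityˡ _))
    g∘r≗0 : ∀ i → g (r (suc i)) ≡ 0#
    g∘r≗0 i = *-cancel-zero (λ eq → Fin.0≢1+n (sym (r-inj (x+y≡0⇒x≡y eq))))
                (trans (sym (factored _)) (f∘r≗0 (suc i)))

  vanishing : List Carrier → Carrier → Carrier
  vanishing []       x = 1#
  vanishing (r ∷ rs) x = (x + r) * vanishing rs x

  degree<-vanishing-* : ∀ {d f} rs → Degree< d f → Degree< (length rs ℕ.+ d) (λ x → vanishing rs x * f x)
  degree<-vanishing-* []       p = degree<-resp (λ x → *-identityˡ _) p
  degree<-vanishing-* (r ∷ rs) p =
    degree<-resp (λ x → *-assoc _ _ _) (degree<-linear r (degree<-vanishing-* rs p))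

  degree<-vanishing : ∀ rs → Degree< (suc (length rs)) (vanishing rs)
  degree<-vanishing []       = horner 1# (degree<-0 {0} {λ _ → 0#} λ _ → refl) λ x →
    solve 1 (λ x → con true := con true :+ x :* con false) refl x
  degree<-vanishing (r ∷ rs) = degree<-linear r (degree<-vanishing rs)

  -- The cofactor g is what remains of 1 / (x + r) once denominators are cleared by the whole
  -- product.
  vanishing-factor : ∀ {r rs} → r ∈ rs →
                     ∃[ g ] Degree< (length rs) g × (∀ x → vanishing rs x ≡ (x + r) * g x)
  vanishing-factor {rs = _ ∷ rs} (here refl) = vanishing rs , degree<-vanishing rs , λ _ → refl
  vanishing-factor {r} {s ∷ _} (there r∈rs) with vanishing-factor r∈rs
  ... | g , p , e = (λ x → (x + s) * g x) , degree<-linear s p , λ x →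
    trans (cong ((x + s) *_) (e x))
      (solve 4 (λ x r s g → (x :+ s) :* ((x :+ r) :* g) := (x :+ r) :* ((x :+ s) :* g)) refl x r s (g x))

  vanishing-∈ : ∀ {r rs} → r ∈ rs → vanishing rs r ≡ 0#
  vanishing-∈ {r} r∈rs with vanishing-factor r∈rs
  ... | g , _ , e = trans (e r) (trans (cong (_* g r) (x+x≡0 r)) (zeroˡ _))

  vanishing-cancel : ∀ {x y} rs → (∀ {r} → r ∈ rs → x ≢ r) → vanishing rs x * y ≡ 0# → y ≡ 0#
  vanishing-cancel []       x∉ eq = trans (sym (*-identityˡ _)) eq
  vanishing-cancel (r ∷ rs) x∉ eq = vanishing-cancel rs (x∉ ∘ there)
    (*-cancel-zero (λ x+r≡0 → x∉ (here refl) (x+y≡0⇒x≡y x+r≡0)) (trans (sym (*-assoc _ _ _)) eq))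

  sum-single : ∀ {n} (f : Fin n → Carrier) i → (∀ j → j ≢ i → f j ≡ 0#) → sum f ≡ f i
  sum-single f zero    f≗0 = trans (cong (f zero +_) (sum-zero (f ∘ suc) λ j → f≗0 (suc j) λ ()))
                                   (+-identityʳ _)
    where
    sum-zero : ∀ {n} (f : Fin n → Carrier) → (∀ j → f j ≡ 0#) → sum f ≡ 0#
    sum-zero {zero}  f f≗0 = refl
    sum-zero {suc n} f f≗0 = trans (cong₂ _+_ (f≗0 zero) (sum-zero (f ∘ suc) (f≗0 ∘ suc))) (+-identityˡ 0#)
  sum-single f (suc i) f≗0 =
    trans (cong₂ _+_ (f≗0 zero λ ()) (sum-single (f ∘ suc) i λ j j≢i → f≗0 (suc j) (j≢i ∘ Fin.suc-injective)))
          (+-identityˡ _)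

-- The syndrome code

-- Decoding is by exhaustive search, since local computation is unrestricted in the model.
Searchable : Set → Set₁
Searchable A = ∀ {P : A → Set} → Decidable₁ P → Dec (∃ P)

searchVec : ∀ {A} → Searchable A → ∀ n → Searchable (Vec A n)
searchVec search zero    P? = map′ ([] ,_) (λ { ([] , p) → p }) (P? [])
searchVec search (suc n) P? =
  map′ (λ (x , xs , p) → x ∷ xs , p) (λ { (x ∷ xs , p) → x , xs , p })
       (search λ x → searchVec search n λ xs → P? (x ∷ xs))

searchList : ∀ {A} → Searchable A → ∀ k {P : List A → Set} → Decidable₁ P →
             Dec (∃[ xs ] length xs ℕ.≤ k × P xs)
searchList search zero    P? = map′ (λ p → [] , z≤n , p) (λ { ([] , _ , p) → p }) (P? [])
searchList search (suc k) P? =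
  map′ (λ { (inj₁ p) → [] , z≤n , p ; (inj₂ (x , xs , l , p)) → x ∷ xs , s≤s l , p })
       (λ { ([] , _ , p) → inj₁ p ; (x ∷ xs , s≤s l , p) → inj₂ (x , xs , l , p) })
       (P? [] ⊎-dec search λ x → searchList search k λ xs → P? (x ∷ xs))

searchFin² : ∀ {n} → Searchable (Fin n × Fin n)
searchFin² P? = map′ (λ (u , v , p) → (u , v) , p) (λ ((u , v) , p) → u , v , p)
                     (Fin.any? λ u → Fin.any? λ v → P? (u , v))

module CauchyCode (F : BinaryField) {n : ℕ}
  (α : Fin n × Fin n → BinaryField.Carrier F) (β : Fin n → BinaryField.Carrier F)
  (α-injective : Injective _≡_ _≡_ α) (β-injective : Injective _≡_ _≡_ β)
  (α≢β : ∀ p w → α p ≢ β w) where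

  open BinaryField F
  open Polynomials F

  Matrix : Set
  Matrix = Fin n → Fin n → Carrier

  SupportedOn : List (Fin n × Fin n) → Matrix → Set
  SupportedOn L D = ∀ u v → D u v ≡ 0# ⊎ (u , v) ∈ L

  AgreeOff : List (Fin n) → (Fin n → Carrier) → (Fin n → Carrier) → Set
  AgreeOff T y z = ∀ w → y w ≡ z w ⊎ w ∈ T

  -- An entry of a Cauchy matrix, 1 / (α p - β w) in characteristic two.
  weight : Fin n × Fin n → Fin n → Carrier
  weight p w = inv (α p + β w)

  syndrome : Matrix → Fin n → Carrier
  syndrome D w = ∑[ u < n ] ∑[ v < n ] (D u v * weight (u , v) w)

  -- Clearing the denominators of ∑ D p / (α p + X) over p ∈ L, and multiplying
  -- by ∏ (X + β w) over w ∈ T, gives a polynomial of degree below n with the n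
  -- roots β w.  Its value at α p is D p up to nonzero factors.
  syndrome-separates : ∀ {D L T} → SupportedOn L D → AgreeOff T (syndrome D) (λ _ → 0#) →
                       suc (length L ℕ.+ length T) ℕ.≤ n → ∀ i j → D i j ≡ 0#
  syndrome-separates {D} {L} {T} supp vanishes bound i j =
    vanishing-cancel α[L′] (α∉ ∘ ∈-map⁻ α) (begin
      vanishing α[L′] a * D i j  ≡⟨ *-comm _ _ ⟩
      D i j * vanishing α[L′] a  ≡⟨ f-at-a ⟨
      f a                        ≡⟨ f-a≡0 ⟩
      0#                         ∎)
    where
    open ≡-Reasoning
    other? = λ (p : Fin n × Fin n) → ¬? (≡-dec Fin._≟_ Fin._≟_ p (i , j))

    -- The position (i , j) is left out because the common denominator gets its factor X + a
    -- separately, whether or not (i , j) lies in `L`.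
    L′ : List (Fin n × Fin n)
    L′ = filter other? L

    α[L′] β[T] : List Carrier
    α[L′] = List.map α L′
    β[T]  = List.map β T

    a : Carrier
    a = α (i , j)

    α∉ : ∀ {r} → (∃[ p ] p ∈ L′ × r ≡ α p) → a ≢ r
    α∉ (p , p∈L′ , refl) eq = proj₂ (∈-filter⁻ other? {xs = L} p∈L′) (sym (α-injective eq))

    -- The summand of (u , v) multiplied by the common denominator (X + a) · `vanishing α[L′]`.
    -- Every summand except that of (i , j) keeps the factor X + a or is zero, hence vanishes at a.
    record Term (u v : Fin n) : Set where
      field
        fun    : Carrier → Carrier
        degree : Degree< (suc (length L′)) fun
        at-β   : ∀ w → fun (β w) ≡ (D u v * weight (u , v) w) * ((β w + a) * vanishing α[L′] (β w))
        at-a   : (u , v) ≢ (i , j) → fun a ≡ 0#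

    invert-denominator : ∀ p w → (β w + α p) * weight p w ≡ 1#
    invert-denominator p w = trans (cong (_* weight p w) (+-comm (β w) (α p)))
                                   (*-inverseʳ (α≢β p w ∘ x+y≡0⇒x≡y))

    main : Term i j
    main = record
      { fun    = λ x → D i j * vanishing α[L′] x
      ; degree = degree<-scale (D i j)
          (subst (λ l → Degree< (suc l) (vanishing α[L′])) (length-map α L′) (degree<-vanishing α[L′]))
      ; at-β   = λ w → let b = β w; d = weight (i , j) w; P = vanishing α[L′] b in begin
          D i j * P                    ≡⟨ *-identityˡ _ ⟨
          1# * (D i j * P)             ≡⟨ cong (_* (D i j * P)) (invert-denominator (i , j) w) ⟨
          ((b + a) * d) * (D i j * P)  ≡⟨ solve 4 (λ s d D P → (s :* d) :* (D :* P) := (D :* d) :* (s :* P)) refl (b + a) d (D i j) P ⟩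
          (D i j * d) * ((b + a) * P)  ∎
      ; at-a   = λ ≢ → contradiction refl ≢
      }

    term : ∀ u v → Term u v
    term u v with ≡-dec Fin._≟_ Fin._≟_ (u , v) (i , j) | supp u v
    ... | yes refl | _ = main
    ... | no uv≢ij | inj₁ D≡0 = record
      { fun    = λ _ → 0#
      ; degree = degree<-0 λ _ → refl
      ; at-β   = λ w → begin
          0#                ≡⟨ solve 2 (λ d y → con false := (con false :* d) :* y) refl (weight (u , v) w) ((β w + a) * vanishing α[L′] (β w)) ⟩
          (0# * _) * _      ≡⟨ cong (λ z → (z * _) * _) D≡0 ⟨
          (D u v * _) * _   ∎
      ; at-a   = λ _ → refl
      }
    ... | no uv≢ij | inj₂ uv∈L
      with vanishing-factor (∈-map⁺ α (∈-filter⁺ other? uv∈L uv≢ij))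
    ...   | g , p , e = record
      { fun    = λ x → D u v * ((x + a) * g x)
      ; degree = degree<-scale (D u v) (degree<-linear a (subst (λ l → Degree< l g) (length-map α L′) p))
      ; at-β   = λ w → let b = β w; d = weight (u , v) w; c = α (u , v) in begin
          D u v * ((b + a) * g b)
            ≡⟨ *-identityʳ _ ⟨
          (D u v * ((b + a) * g b)) * 1#
            ≡⟨ cong (D u v * ((b + a) * g b) *_) (invert-denominator (u , v) w) ⟨
          (D u v * ((b + a) * g b)) * ((b + c) * d)
            ≡⟨ solve 5 (λ D s g t d → (D :* (s :* g)) :* (t :* d) := (D :* d) :* (s :* (t :* g))) refl (D u v) (b + a) (g b) (b + c) d ⟩
          (D u v * d) * ((b + a) * ((b + c) * g b))
            ≡⟨ cong (λ y → (D u v * d) * ((b + a) * y)) (e b) ⟨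
          (D u v * d) * ((b + a) * vanishing α[L′] b)
            ∎
      ; at-a   = λ _ → solve 3 (λ D a g → D :* ((a :+ a) :* g) := con false) refl (D u v) a (g a)
      }

    t : Fin n → Fin n → Carrier → Carrier
    t u v = Term.fun (term u v)

    f : Carrier → Carrier
    f x = ∑[ u < n ] ∑[ v < n ] t u v x

    f-degree : Degree< (suc (length L′)) f
    f-degree = degree<-sum _ λ u → degree<-sum _ λ v → Term.degree (term u v)

    f-at-β : ∀ w → f (β w) ≡ syndrome D w * ((β w + a) * vanishing α[L′] (β w))
    f-at-β w = begin
      f (β w)
        ≡⟨ sum-cong-≗ (λ u → trans (sum-cong-≗ λ v → Term.at-β (term u v) w) (sym (*-distribʳ-sum {n} c _))) ⟩
      ∑[ u < n ] (∑[ v < n ] (D u v * weight (u , v) w) * c)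
        ≡⟨ *-distribʳ-sum {n} c (λ u → ∑[ v < n ] (D u v * weight (u , v) w)) ⟨
      syndrome D w * c
        ∎
      where c = (β w + a) * vanishing α[L′] (β w)

    f-at-a : f a ≡ D i j * vanishing α[L′] a
    f-at-a = begin
      f a                          ≡⟨ sum-single _ i (λ u u≢i → trans
                                        (sum-single _ j λ v _ → Term.at-a (term u v) (u≢i ∘ cong proj₁))
                                        (Term.at-a (term u j) (u≢i ∘ cong proj₁))) ⟩
      ∑[ v < n ] t i v a           ≡⟨ sum-single _ j (λ v v≢j → Term.at-a (term i v) (v≢j ∘ cong proj₂)) ⟩
      t i j a                      ≡⟨ at-ij ⟩
      D i j * vanishing α[L′] a    ∎
      where
      -- `term i j` reduces to `main` only after its equality test has been decided.
      at-ij : t i j a ≡ D i j * vanishing α[L′] a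
      at-ij with ≡-dec Fin._≟_ Fin._≟_ (i , j) (i , j)
      ... | yes refl = refl
      ... | no ≢     = contradiction refl ≢

    product-vanishes : ∀ w → vanishing β[T] (β w) * f (β w) ≡ 0#
    product-vanishes w with vanishes w
    ... | inj₁ s≡0 = trans (cong (vanishing β[T] (β w) *_) (trans (f-at-β w) (trans (cong (_* ((β w + a) * vanishing α[L′] (β w))) s≡0) (zeroˡ _)))) (zeroʳ _)
    ... | inj₂ w∈T = trans (cong (_* f (β w)) (vanishing-∈ (∈-map⁺ β w∈T))) (zeroˡ _)

    degree-bound : length β[T] ℕ.+ suc (length L′) ℕ.≤ n
    degree-bound rewrite length-map β T | ℕ.+-comm (length T) (suc (length L′)) =
      -- If (i , j) is not in `L`, filtering removes nothing; this is where the 1 in the bound is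
      -- spent.
      ℕ.≤-trans (s≤s (ℕ.+-monoˡ-≤ (length T) (length-filter other? L))) bound

    f-a≡0 : f a ≡ 0#
    f-a≡0 = vanishing-cancel β[T] (λ r∈ → a∉β (∈-map⁻ β r∈))
      (degree<-roots β β-injective (degree<-mono degree-bound (degree<-vanishing-* β[T] f-degree)) product-vanishes a)
      where
      a∉β : ∀ {r} → (∃[ w ] w ∈ T × r ≡ β w) → a ≢ r
      a∉β (w , _ , refl) = α≢β (i , j) w

  syndrome-cong : ∀ {D E} → (∀ u v → D u v ≡ E u v) → ∀ w → syndrome D w ≡ syndrome E w
  syndrome-cong D≗E w = sum-cong-≗ λ u → sum-cong-≗ λ v → cong (_* weight (u , v) w) (D≗E u v)

  syndrome-+ : ∀ D E w → syndrome (λ u v → D u v + E u v) w ≡ syndrome D w + syndrome E w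
  syndrome-+ D E w = begin
    ∑[ u < n ] ∑[ v < n ] ((D u v + E u v) * weight (u , v) w)
      ≡⟨ sum-cong-≗ (λ u → trans (sum-cong-≗ λ v → distribʳ _ (D u v) (E u v))
           (∑-distrib-+ (λ v → D u v * weight (u , v) w) (λ v → E u v * weight (u , v) w))) ⟩
    ∑[ u < n ] (∑[ v < n ] (D u v * weight (u , v) w) + ∑[ v < n ] (E u v * weight (u , v) w))
      ≡⟨ ∑-distrib-+ (λ u → ∑[ v < n ] (D u v * weight (u , v) w)) (λ u → ∑[ v < n ] (E u v * weight (u , v) w)) ⟩
    syndrome D w + syndrome E w
      ∎
    where open ≡-Reasoning

  -- The decoder's criterion for a candidate error: at most s direct messages were spoiled, and at
  -- most t of the announced coordinates `y` are wrong.
  Explains : ℕ → ℕ → (Fin n → Carrier) → Matrix → Set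
  Explains s t y D = (∃[ L ] length L ℕ.≤ s × SupportedOn L D)
                   × (∃[ T ] length T ℕ.≤ t × AgreeOff T y (syndrome D))

  explains? : ∀ s t y D → Dec (Explains s t y D)
  explains? s t y D =
    searchList searchFin² s (λ L → Fin.all? λ u → Fin.all? λ v → (D u v ≟ 0#) ⊎-dec ((u , v) ∈²? L))
    ×-dec
    searchList Fin.any? t (λ T → Fin.all? λ w → (y w ≟ syndrome D w) ⊎-dec (w ∈? T))
    where
    open DecMembership Fin._≟_ using (_∈?_)
    open DecMembership (≡-dec Fin._≟_ Fin._≟_) using () renaming (_∈?_ to _∈²?_)

  explains-resp : ∀ {s t y D E} → (∀ u v → D u v ≡ E u v) → Explains s t y D → Explains s t y E
  explains-resp D≗E ((L , l , supp) , (T , l′ , agree)) =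
    (L , l , λ u v → subst (λ x → x ≡ 0# ⊎ (u , v) ∈ L) (D≗E u v) (supp u v)) ,
    (T , l′ , λ w → subst (λ x → _ ≡ x ⊎ w ∈ T) (syndrome-cong D≗E w) (agree w))

  -- The difference of two explanations, which is their sum here, has at most 2s nonzero entries,
  -- and its syndrome vanishes off at most 2t coordinates, so `syndrome-separates` forces it to be
  -- zero.
  explanation-unique : ∀ {s t y D E} → suc ((s ℕ.+ s) ℕ.+ (t ℕ.+ t)) ℕ.≤ n →
                       Explains s t y D → Explains s t y E → ∀ u v → D u v ≡ E u v
  explanation-unique {y = y} {D} {E} bound ((L , l , D-supp) , (T , m , D-agree)) ((L′ , l′ , E-supp) , (T′ , m′ , E-agree)) u v =
    x+y≡0⇒x≡y (syndrome-separates {λ u v → D u v + E u v} {L List.++ L′} {T List.++ T′} supp agree bound′ u v)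
    where
    supp : SupportedOn (L List.++ L′) (λ u v → D u v + E u v)
    supp u v with D-supp u v | E-supp u v
    ... | inj₁ D≡0 | inj₁ E≡0 = inj₁ (trans (cong₂ _+_ D≡0 E≡0) (+-identityˡ 0#))
    ... | inj₂ ∈L  | _        = inj₂ (∈-++⁺ˡ ∈L)
    ... | _        | inj₂ ∈L′ = inj₂ (∈-++⁺ʳ L ∈L′)
    agree : AgreeOff (T List.++ T′) (syndrome (λ u v → D u v + E u v)) (λ _ → 0#)
    agree w with D-agree w | E-agree w
    ... | inj₁ y≡D | inj₁ y≡E = inj₁ (trans (syndrome-+ D E w)
                                  (trans (cong₂ _+_ (sym y≡D) (sym y≡E)) (x+x≡0 (y w))))
    ... | inj₂ ∈T  | _        = inj₂ (∈-++⁺ˡ ∈T)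
    ... | _        | inj₂ ∈T′ = inj₂ (∈-++⁺ʳ T ∈T′)
    bound′ : suc (length (L List.++ L′) ℕ.+ length (T List.++ T′)) ℕ.≤ n
    bound′ rewrite length-++ L {L′} | length-++ T {T′} =
      ℕ.≤-trans (s≤s (ℕ.+-mono-≤ (ℕ.+-mono-≤ l l′) (ℕ.+-mono-≤ m m′))) bound

  entries : Vec (Vec Carrier n) n → Matrix
  entries D u v = Vec.lookup (Vec.lookup D u) v

  searchCarrier : Searchable Carrier
  searchCarrier {P} P? = map′ (λ (bs , p) → decode bs , p)
                              (λ (x , p) → encode x , subst P (sym (decode-encode x)) p)
                              -- A subset of `Fin width` is a vector of `width` booleans, that is,
                              -- the code of a field element.
                              (anySubset? (P? ∘ decode))

  explanation? : ∀ s t y → Dec (∃[ D ] Explains s t y (entries D))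
  explanation? s t y = searchVec (searchVec searchCarrier n) n (explains? s t y ∘ entries)

  correct : ℕ → ℕ → (Fin n → Carrier) → Matrix
  correct s t y with explanation? s t y
  ... | yes (D , _) = entries D
  -- A default value; `correct-≗` rules this case out whenever an explanation exists.
  ... | no _        = λ _ _ → 0#

  correct-≗ : ∀ {s t y E} → suc ((s ℕ.+ s) ℕ.+ (t ℕ.+ t)) ℕ.≤ n → Explains s t y E →
              ∀ u v → correct s t y u v ≡ E u v
  correct-≗ {s} {t} {y} {E} bound E-explains with explanation? s t y
  ... | yes (_ , D-explains) = explanation-unique bound D-explains E-explains
  -- The search ranges over vectors, so `E` has to be tabulated before it counts as a witness.
  ... | no none = contradiction (Vec.tabulate (Vec.tabulate ∘ E) , explains-resp entry E-explains) none
    where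
    entry : ∀ u v → E u v ≡ entries (Vec.tabulate (Vec.tabulate ∘ E)) u v
    entry u v = sym (trans (cong (λ row → Vec.lookup row v) (Vec.lookup∘tabulate (Vec.tabulate ∘ E) u))
                           (Vec.lookup∘tabulate (E u) v))

-- Probabilities of coinciding events

Pr-cong : ∀ {n ρ} {E E′ : Vec (Vec Bool ρ) n → Bool} → (∀ tapes → E tapes ≡ E′ tapes) → Pr E ≡ Pr E′
Pr-cong {n} {ρ} {E} {E′} E≗E′ = cong (λ l → ℚ._/_ (ℤ.+ length l) (2 ℕ.^ (ρ ℕ.* n)) {{ℕ.m^n≢0 2 (ρ ℕ.* n)}})
  (filter-≐ (λ tapes → T? (E tapes)) (λ tapes → T? (E′ tapes))
     ((λ {tapes} → subst Bool.T (E≗E′ tapes)) , (λ {tapes} → subst Bool.T (sym (E≗E′ tapes))))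
     (allTapes n ρ))

-- The simulation is exact on every choice of tapes, so the two output distributions are equal and
-- any nonnegative error bound is met.
p≡q⇒∣p-q∣≤ε : ∀ {p q ε} → 0ℚ ℚ.≤ ε → p ≡ q → ℚ.∣ p ℚ.- q ∣ ℚ.≤ ε
p≡q⇒∣p-q∣≤ε {p} {ε = ε} 0≤ε refl = subst (λ z → ℚ.∣ z ∣ ℚ.≤ ε) (sym (ℚ.+-inverseʳ p)) 0≤ε

0≤1/n^c : ∀ n c .{{_ : NonZero n}} → 0ℚ ℚ.≤ 1/ n ^ c
0≤1/n^c n c = ℚ.nonNegative⁻¹ _ {{ℚ.normalize-nonNeg 1 (n ℕ.^ c) {{ℕ.m^n≢0 n c}}}}

-- Executions

lookup-transpose : ∀ {A : Set} {m n} (M : Vec (Vec A n) m) j → lookup (transpose M) j ≡ Vec.map (λ row → lookup row j) M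
lookup-transpose []      j = Vec.lookup-replicate j []
lookup-transpose {n = n} (row ∷ M) j = begin
  lookup ((replicate n Vec._∷_ Vec.⊛ row) Vec.⊛ transpose M) j
    ≡⟨ Vec.lookup-⊛ j (replicate n Vec._∷_ Vec.⊛ row) (transpose M) ⟩
  lookup (replicate n Vec._∷_ Vec.⊛ row) j (lookup (transpose M) j)
    ≡⟨ cong (λ g → g (lookup (transpose M) j))
         (trans (Vec.lookup-⊛ j (replicate n Vec._∷_) row) (cong (λ g → g (lookup row j)) (Vec.lookup-replicate j Vec._∷_))) ⟩
  lookup row j ∷ lookup (transpose M) j
    ≡⟨ cong (lookup row j ∷_) (lookup-transpose M j) ⟩
  lookup row j ∷ Vec.map (λ row → lookup row j) M
    ∎
  where open ≡-Reasoning

module _ {n w : ℕ} (ch : Channel n w) (past : List (Traffic n w)) (outbox : Fin n → Vec (Message w) n) where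

  inbox : Fin n → Vec (Message w) n
  inbox v = lookup (transpose (ch (tabulate outbox) past)) v

module _ {n w : ℕ} {I O : Set} (A : Algorithm n w I O) (ch : Channel n w) where
  open Algorithm A

  -- Unfolds one round while keeping the states in the form `tabulate S`, so that they can be
  -- treated as functions on the nodes.
  execute-suc : ∀ k past (S : Fin n → State) →
    execute A ch (suc k) past (tabulate S) ≡
    execute A ch k (tabulate (λ u → send u (S u)) ∷ past)
      (tabulate λ v → receive v (S v) (inbox ch past (λ u → send u (S u)) v))
  execute-suc k past S
    rewrite Vec.tabulate-cong {f = λ u → send u (lookup (tabulate S) u)} {g = λ u → send u (S u)}
              (λ u → cong (send u) (Vec.lookup∘tabulate S u)) =
    cong (execute A ch k _) (Vec.tabulate-cong λ v → cong (λ s → receive v s (inbox ch past (λ u → send u (S u)) v)) (Vec.lookup∘tabulate S v))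

-- Messages within reach of the adversary

module _ {n : ℕ} where

  -- An edge carries one message in each direction, hence the factor 2 in all later counts.
  links : List (Edge n) → List (Fin n × Fin n)
  links []      = []
  links (e ∷ F) = (lo , hi) ∷ (hi , lo) ∷ links F
    where open Edge e

  length-links : ∀ F → length (links F) ≡ length F ℕ.* 2
  length-links []      = refl
  length-links (_ ∷ F) = cong (2 ℕ.+_) (length-links F)

  Joins : Fin n → Fin n → Edge n → Set
  Joins u v e = (lo ≡ u × hi ≡ v) ⊎ (lo ≡ v × hi ≡ u)
    where open Edge e

  joins⇒∈-links : ∀ {u v F} → Any (Joins u v) F → (u , v) ∈ links F
  joins⇒∈-links (here (inj₁ (refl , refl))) = here refl
  joins⇒∈-links (here (inj₂ (refl , refl))) = there (here refl)
  joins⇒∈-links (there p)                   = there (there (joins⇒∈-links p))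

  controls⇒∈-links : ∀ F u v → controls F u v ≡ false ⊎ (u , v) ∈ links F
  -- `controls F u v` unfolds to `does` of this very decision, so a case split on it settles both
  -- alternatives.
  controls⇒∈-links F u v = cases (any? joins? F)
    where
    joins? = λ e → ((Edge.lo e Fin.≟ u) ×-dec (Edge.hi e Fin.≟ v)) ⊎-dec ((Edge.lo e Fin.≟ v) ×-dec (Edge.hi e Fin.≟ u))
    cases : (joined : Dec (Any (Joins u v) F)) → does joined ≡ false ⊎ (u , v) ∈ links F
    cases (yes p) = inj₂ (joins⇒∈-links p)
    cases (no _)  = inj₁ refl

module _ {n w : ℕ} (past : List (Traffic n w)) (outbox : Fin n → Vec (Message w) n) where

  lookup-inbox : ∀ ch u v → lookup (inbox ch past outbox v) u ≡ lookup (lookup (ch (tabulate outbox) past) u) v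
  lookup-inbox ch u v = trans (cong (λ row → lookup row u) (lookup-transpose (ch (tabulate outbox) past) v))
                              (Vec.lookup-map u (λ row → lookup row v) (ch (tabulate outbox) past))

  faultFree-delivers : ∀ u v → lookup (inbox faultFree past outbox v) u ≡ lookup (outbox u) v
  faultFree-delivers u v = trans (lookup-inbox faultFree u v)
                                 (cong (λ row → lookup row v) (Vec.lookup∘tabulate outbox u))

  module _ {f : ℕ} (adv : Adversary n w f) where
    open Attack (adv (tabulate outbox) past)

    lookup-tampered : ∀ u v → controls edges u v ≡ false →
                      lookup (inbox (tampered adv) past outbox v) u ≡ lookup (outbox u) v
    lookup-tampered u v uncontrolled = begin
      lookup (inbox (tampered adv) past outbox v) u
        ≡⟨ lookup-inbox (tampered adv) u v ⟩
      lookup (lookup (tampered adv (tabulate outbox) past) u) v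
        ≡⟨ cong (λ row → lookup row v) (Vec.lookup∘tabulate _ u) ⟩
      lookup (tabulate _) v
        ≡⟨ Vec.lookup∘tabulate _ v ⟩
      (if controls edges u v then lookup (lookup forged u) v else lookup (lookup (tabulate outbox) u) v)
        ≡⟨ cong (if_then lookup (lookup forged u) v else lookup (lookup (tabulate outbox) u) v) uncontrolled ⟩
      lookup (lookup (tabulate outbox) u) v
        ≡⟨ cong (λ row → lookup row v) (Vec.lookup∘tabulate outbox u) ⟩
      lookup (outbox u) v
        ∎
      where
      open ≡-Reasoning

    -- All that the analysis of the three rounds uses about the adversary. One list `L` serves all
    -- receivers of the round at once.
    tampered-delivers : ∃[ L ] length L ℕ.≤ f ℕ.* 2 ×
      (∀ u v → lookup (inbox (tampered adv) past outbox v) u ≡ lookup (outbox u) v ⊎ (u , v) ∈ L)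
    tampered-delivers =
      links edges ,
      subst (ℕ._≤ f ℕ.* 2) (sym (length-links edges)) (ℕ.*-monoˡ-≤ 2 atMost) ,
      λ u v → [ inj₁ ∘ lookup-tampered u v , inj₂ ]′ (controls⇒∈-links edges u v)

-- Three rounds for one

module Compiler (F : BinaryField) {n : ℕ}
  (α : Fin n × Fin n → BinaryField.Carrier F) (β : Fin n → BinaryField.Carrier F)
  (α-injective : Injective _≡_ _≡_ α) (β-injective : Injective _≡_ _≡_ β)
  (α≢β : ∀ p w → α p ≢ β w)
  {w w′ : ℕ} (w≤width : w ℕ.≤ BinaryField.width F) (width≤w′ : BinaryField.width F ℕ.≤ w′)
  {I O : Set} (A : Algorithm n w I O) (f : ℕ)
  where

  open BinaryField F
  open CauchyCode F α β α-injective β-injective α≢β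
  open Algorithm A

  w≤w′ : w ℕ.≤ w′
  w≤w′ = ℕ.≤-trans w≤width width≤w′

  embed : Message w → Carrier
  embed = decode ∘ padRight w≤width false

  extract : Carrier → Message w
  extract = truncate w≤width ∘ encode

  extract-embed : ∀ m → extract (embed m) ≡ m
  extract-embed m = trans (cong (truncate w≤width) (encode-decode _)) (Vec.truncate-padRight w≤width false m)

  toWire : Carrier → Message w′
  toWire = padRight width≤w′ false ∘ encode

  fromWire : Message w′ → Carrier
  fromWire = decode ∘ truncate width≤w′

  fromWire-toWire : ∀ x → fromWire (toWire x) ≡ x
  fromWire-toWire x = trans (cong decode (Vec.truncate-padRight width≤w′ false _)) (decode-encode x)

  -- The original state advances only in the third round and is carried along until then, first with
  -- the possibly tampered messages, then also with the coordinate that the node has added up.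
  data Phase : Set where
    idle     : State → Phase
    received : State → Vec (Message w) n → Phase
    summed   : State → Vec (Message w) n → Carrier → Phase

  -- The part of the syndrome of (received + sent) that v can compute: what it
  -- received is column v, what it sent is row v.
  share : Fin n → State → Vec (Message w) n → Fin n → Carrier
  share v s ms x = ∑[ u < n ] (embed (lookup ms u) * weight (u , v) x)
                 + ∑[ u < n ] (embed (lookup (send v s) u) * weight (v , u) x)

  sendPhase : Fin n → Phase → Vec (Message w′) n
  sendPhase v (idle s)         = Vec.map (padRight w≤w′ false) (send v s)
  sendPhase v (received s ms)  = tabulate (toWire ∘ share v s ms)
  sendPhase v (summed s ms y)  = replicate n (toWire y)

  receivePhase : Fin n → Phase → Vec (Message w′) n → Phase
  receivePhase v (idle s)        ms′ = received s (Vec.map (truncate w≤w′) ms′)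
  receivePhase v (received s ms) ms′ = summed s ms (∑[ u < n ] fromWire (lookup ms′ u))
  -- In characteristic two adding the error removes it. The budgets are 2f entries for the first
  -- round, and 2f coordinates for each of the second and third.
  receivePhase v (summed s ms _) ms′ = idle (receive v s (tabulate λ u →
    extract (embed (lookup ms u) + correct (f ℕ.* 2) (f ℕ.* 2 ℕ.+ f ℕ.* 2) (fromWire ∘ lookup ms′) u v)))

  outputPhase : Fin n → Phase → O
  outputPhase v (idle s)       = output v s
  outputPhase v (received s _) = output v s
  outputPhase v (summed s _ _) = output v s

  compiled : Algorithm n w′ I O
  compiled = record
    { rounds  = rounds ℕ.* 3
    ; coins   = coins
    ; State   = Phase
    ; init    = λ v i tape → idle (init v i tape)
    ; send    = sendPhase
    ; receive = receivePhase
    ; output  = outputPhase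
    }

  -- This is 12f < n: the bound of `explanation-unique` with s = 2f and t = 4f.
  module _ (bound : suc ((f ℕ.* 2 ℕ.+ f ℕ.* 2) ℕ.+ ((f ℕ.* 2 ℕ.+ f ℕ.* 2) ℕ.+ (f ℕ.* 2 ℕ.+ f ℕ.* 2))) ℕ.≤ n)
           (adv : Adversary n w′ f) where

    module _ (past : List (Traffic n w′)) (S : Fin n → State) where
      open DecMembership (Fin._≟_ {n}) using (_∈?_)

      out₁ out₂ out₃ : Fin n → Vec (Message w′) n
      phase₁ phase₂ phase₃ : Fin n → Phase
      past₂ past₃ past₄ : List (Traffic n w′)

      out₁ v   = sendPhase v (idle (S v))
      phase₁ v = receivePhase v (idle (S v)) (inbox (tampered adv) past out₁ v)
      past₂    = tabulate out₁ ∷ past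
      out₂ v   = sendPhase v (phase₁ v)
      phase₂ v = receivePhase v (phase₁ v) (inbox (tampered adv) past₂ out₂ v)
      past₃    = tabulate out₂ ∷ past₂
      out₃ v   = sendPhase v (phase₂ v)
      phase₃ v = receivePhase v (phase₂ v) (inbox (tampered adv) past₃ out₃ v)
      past₄    = tabulate out₃ ∷ past₃

      rcv : Fin n → Fin n → Message w
      rcv u v = lookup (Vec.map (truncate w≤w′) (inbox (tampered adv) past out₁ v)) u

      msg : Fin n → Fin n → Message w
      msg u v = lookup (send u (S u)) v

      error : Matrix
      error u v = embed (rcv u v) + embed (msg u v)

      sums : Fin n → Carrier
      sums x = ∑[ v < n ] fromWire (lookup (inbox (tampered adv) past₂ out₂ x) v)

      error-support : ∃[ L ] length L ℕ.≤ f ℕ.* 2 × SupportedOn L error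
      error-support with tampered-delivers past out₁ adv
      ... | L , l , delivers = L , l , supp
        where
        open ≡-Reasoning
        supp : SupportedOn L error
        supp u v with delivers u v
        ... | inj₂ uv∈L = inj₂ uv∈L
        ... | inj₁ eq   = inj₁ (trans (cong (λ m → embed m + embed (msg u v)) rcv≡msg) (x+x≡0 _))
          where
          rcv≡msg : rcv u v ≡ msg u v
          rcv≡msg = begin
            rcv u v
              ≡⟨ Vec.lookup-map u (truncate w≤w′) (inbox (tampered adv) past out₁ v) ⟩
            truncate w≤w′ (lookup (inbox (tampered adv) past out₁ v) u)
              ≡⟨ cong (truncate w≤w′) eq ⟩
            truncate w≤w′ (lookup (out₁ u) v)
              ≡⟨ cong (truncate w≤w′) (Vec.lookup-map v (padRight w≤w′ false) (send u (S u))) ⟩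
            truncate w≤w′ (padRight w≤w′ false (msg u v))
              ≡⟨ Vec.truncate-padRight w≤w′ false (msg u v) ⟩
            msg u v
              ∎

      -- The received part is shared out by columns and the sent part by rows. Exchanging the two
      -- sums in the former brings both to the order of `syndrome`, which is additive.
      sum-shares : ∀ x → ∑[ v < n ] share v (S v) (Vec.map (truncate w≤w′) (inbox (tampered adv) past out₁ v)) x
                         ≡ syndrome error x
      sum-shares x = begin
        ∑[ v < n ] (∑[ u < n ] R u v + ∑[ u < n ] M v u)
          ≡⟨ ∑-distrib-+ (λ v → ∑[ u < n ] R u v) (λ v → ∑[ u < n ] M v u) ⟩
        ∑[ v < n ] ∑[ u < n ] R u v + ∑[ v < n ] ∑[ u < n ] M v u
          ≡⟨ cong (_+ ∑[ v < n ] ∑[ u < n ] M v u) (∑-comm (λ v u → R u v)) ⟩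
        syndrome (λ u v → embed (rcv u v)) x + syndrome (λ u v → embed (msg u v)) x
          ≡⟨ syndrome-+ (λ u v → embed (rcv u v)) (λ u v → embed (msg u v)) x ⟨
        syndrome error x
          ∎
        where
        open ≡-Reasoning
        R M : Matrix
        R u v = embed (rcv u v) * weight (u , v) x
        M u v = embed (msg u v) * weight (u , v) x

      -- A spoiled share can ruin only the sum of its receiver, so `T` collects the receivers of
      -- spoiled messages.
      sums-agree : ∃[ T ] length T ℕ.≤ f ℕ.* 2 × AgreeOff T sums (syndrome error)
      sums-agree with tampered-delivers past₂ out₂ adv
      ... | L , l , delivers = T , subst (ℕ._≤ f ℕ.* 2) (sym (length-map proj₂ L)) l , agree
        where
        T : List (Fin n)
        T = List.map proj₂ L
        agree : AgreeOff T sums (syndrome error)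
        agree x with x ∈? T
        ... | yes x∈T = inj₂ x∈T
        ... | no x∉T  = inj₁ (trans (sum-cong-≗ eq) (sum-shares x))
          where
          eq : ∀ v → fromWire (lookup (inbox (tampered adv) past₂ out₂ x) v) ≡
                     share v (S v) (Vec.map (truncate w≤w′) (inbox (tampered adv) past out₁ v)) x
          eq v = [ (λ e → trans (cong fromWire (trans e (Vec.lookup∘tabulate _ x))) (fromWire-toWire _))
                 , (λ ∈L → contradiction (∈-map⁺ proj₂ ∈L) x∉T) ]′ (delivers v x)

      -- A coordinate reaches v wrong only if its announcement was spoiled, which is charged to the
      -- sender, or if the announced sum was already wrong.
      error-explains : ∀ v → Explains (f ℕ.* 2) (f ℕ.* 2 ℕ.+ f ℕ.* 2)
                               (fromWire ∘ lookup (inbox (tampered adv) past₃ out₃ v)) error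
      error-explains v with sums-agree | tampered-delivers past₃ out₃ adv
      ... | T , l , agree | L , l′ , delivers =
        error-support , (T′ List.++ T) , length≤ , agree′
        where
        T′ : List (Fin n)
        T′ = List.map proj₁ L
        length≤ : length (T′ List.++ T) ℕ.≤ f ℕ.* 2 ℕ.+ f ℕ.* 2
        length≤ rewrite length-++ T′ {T} | length-map proj₁ L = ℕ.+-mono-≤ l′ l
        agree′ : AgreeOff (T′ List.++ T) (fromWire ∘ lookup (inbox (tampered adv) past₃ out₃ v)) (syndrome error)
        agree′ x with delivers x v | agree x
        ... | inj₁ e  | inj₁ e′  = inj₁ (trans (cong fromWire (trans e (Vec.lookup-replicate v _)))
                                            (trans (fromWire-toWire _) e′))
        ... | inj₂ ∈L | _        = inj₂ (∈-++⁺ˡ (∈-map⁺ proj₁ ∈L))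
        ... | _       | inj₂ x∈T = inj₂ (∈-++⁺ʳ T′ x∈T)

      -- The true error explains what v hears, so v decodes exactly that error and recovers its
      -- fault-free inbox. `past₀` is arbitrary because a fault-free channel ignores the history.
      phase₃-correct : ∀ past₀ v → phase₃ v ≡ idle (receive v (S v) (inbox faultFree past₀ (λ u → send u (S u)) v))
      phase₃-correct past₀ v = cong (idle ∘ receive v (S v)) (begin
        tabulate (λ u → extract (embed (rcv u v) + correct _ _ y u v))
          ≡⟨ Vec.tabulate-cong (λ u → trans (cong extract (recover u)) (extract-embed (msg u v))) ⟩
        tabulate (λ u → msg u v)
          ≡⟨ Vec.tabulate-cong (λ u → faultFree-delivers past₀ (λ u → send u (S u)) u v) ⟨
        tabulate (lookup (inbox faultFree past₀ (λ u → send u (S u)) v))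
          ≡⟨ Vec.tabulate∘lookup _ ⟩
        inbox faultFree past₀ (λ u → send u (S u)) v
          ∎)
        where
        open ≡-Reasoning
        y : Fin n → Carrier
        y = fromWire ∘ lookup (inbox (tampered adv) past₃ out₃ v)
        recover : ∀ u → embed (rcv u v) + correct (f ℕ.* 2) (f ℕ.* 2 ℕ.+ f ℕ.* 2) y u v ≡ embed (msg u v)
        recover u = trans (cong (embed (rcv u v) +_) (correct-≗ bound (error-explains v) u v))
          (solve 2 (λ r m → r :+ (r :+ m) := m) refl (embed (rcv u v)) (embed (msg u v)))

    -- Induction on the simulated rounds. The two histories are independent variables: the compiled
    -- run records three traffic matrices per simulated round, and decoding succeeds whatever the
    -- adversary has seen.
    execute-compiled : ∀ k past past₀ (S : Fin n → State) →
      execute compiled (tampered adv) (k ℕ.* 3) past (tabulate (idle ∘ S)) ≡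
      Vec.map idle (execute A faultFree k past₀ (tabulate S))
    execute-compiled zero    past past₀ S = Vec.tabulate-∘ idle S
    execute-compiled (suc k) past past₀ S = begin
      execute compiled ch (3 ℕ.+ k ℕ.* 3) past (tabulate (idle ∘ S))
        ≡⟨ execute-suc compiled ch (2 ℕ.+ k ℕ.* 3) past (idle ∘ S) ⟩
      execute compiled ch (2 ℕ.+ k ℕ.* 3) (past₂ past S) (tabulate (phase₁ past S))
        ≡⟨ execute-suc compiled ch (1 ℕ.+ k ℕ.* 3) (past₂ past S) (phase₁ past S) ⟩
      execute compiled ch (1 ℕ.+ k ℕ.* 3) (past₃ past S) (tabulate (phase₂ past S))
        ≡⟨ execute-suc compiled ch (k ℕ.* 3) (past₃ past S) (phase₂ past S) ⟩
      execute compiled ch (k ℕ.* 3) (past₄ past S) (tabulate (phase₃ past S))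
        ≡⟨ cong (execute compiled ch (k ℕ.* 3) (past₄ past S)) (Vec.tabulate-cong (phase₃-correct past S past₀)) ⟩
      execute compiled ch (k ℕ.* 3) (past₄ past S) (tabulate (idle ∘ S′))
        ≡⟨ execute-compiled k (past₄ past S) _ S′ ⟩
      Vec.map idle (execute A faultFree k (tabulate (λ u → send u (S u)) ∷ past₀) (tabulate S′))
        ≡⟨ cong (Vec.map idle) (execute-suc A faultFree k past₀ S) ⟨
      Vec.map idle (execute A faultFree (suc k) past₀ (tabulate S))
        ∎
      where
      open ≡-Reasoning
      ch = tampered adv
      S′ : Fin n → State
      S′ v = receive v (S v) (inbox faultFree past₀ (λ u → send u (S u)) v)

    run-compiled : ∀ inputs tapes → run compiled (tampered adv) inputs tapes ≡ run A faultFree inputs tapes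
    run-compiled inputs tapes = Vec.tabulate-cong λ v → cong (outputPhase v) (begin
      lookup (execute compiled (tampered adv) (rounds ℕ.* 3) [] (tabulate (idle ∘ start))) v
        ≡⟨ cong (λ states → lookup states v) (execute-compiled rounds [] [] start) ⟩
      lookup (Vec.map idle (execute A faultFree rounds [] (tabulate start))) v
        ≡⟨ Vec.lookup-map v idle (execute A faultFree rounds [] (tabulate start)) ⟩
      idle (lookup (execute A faultFree rounds [] (tabulate start)) v)
        ∎)
      where
      open ≡-Reasoning
      start : Fin n → State
      start v = init v (lookup inputs v) (lookup tapes v)

  compiled-resilient : ∀ {ε} → 0ℚ ℚ.≤ ε →
    suc ((f ℕ.* 2 ℕ.+ f ℕ.* 2) ℕ.+ ((f ℕ.* 2 ℕ.+ f ℕ.* 2) ℕ.+ (f ℕ.* 2 ℕ.+ f ℕ.* 2))) ≤ n →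
    ResilientlyEquivalent f ε A compiled
  compiled-resilient 0≤ε bound inputs adv E =
    p≡q⇒∣p-q∣≤ε 0≤ε (Pr-cong λ tapes → cong E (run-compiled bound adv inputs tapes))

open import Data.Nat using (_*_)

-- Adversaries without edges

module _ {n w : ℕ} {I O : Set} (A : Algorithm n w I O) {ch ch′ : Channel n w}
  (ch≗ch′ : ∀ sent past → ch sent past ≡ ch′ sent past) where
  open Algorithm A

  execute-cong : ∀ k past S → execute A ch k past S ≡ execute A ch′ k past S
  execute-cong zero    past S = refl
  execute-cong (suc k) past S = trans (execute-cong k (sent ∷ past) (next (ch sent past)))
    (cong (execute A ch′ k (sent ∷ past) ∘ next) (ch≗ch′ sent past))
    where
    sent : Traffic n w
    sent = tabulate λ u → send u (lookup S u)
    next : Traffic n w → Vec State n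
    next delivered = tabulate λ v → receive v (lookup S v) (lookup (transpose delivered) v)

  run-cong : ∀ inputs tapes → run A ch inputs tapes ≡ run A ch′ inputs tapes
  run-cong inputs tapes = Vec.tabulate-cong λ v → cong (λ states → output v (lookup states v))
    (execute-cong rounds [] (tabulate λ v → init v (lookup inputs v) (lookup tapes v)))

tampered-0 : ∀ {n w} (adv : Adversary n w 0) sent past → tampered adv sent past ≡ sent
tampered-0 adv sent past with adv sent past
-- `atMost` excludes a nonempty list, and on the empty one every `controls` test computes to
-- `false`.
... | record { edges = [] } = trans (Vec.tabulate-cong λ u → Vec.tabulate∘lookup (lookup sent u)) (Vec.tabulate∘lookup sent)

resilient-0 : ∀ {n w I O} (A : Algorithm n w I O) {ε} → 0ℚ ℚ.≤ ε → ResilientlyEquivalent 0 ε A A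
resilient-0 A 0≤ε inputs adv E = p≡q⇒∣p-q∣≤ε 0≤ε
  (Pr-cong λ tapes → cong E (run-cong A (tampered-0 adv) inputs tapes))

-- Choice of the field

-- Strong induction along n ↦ ⌈n/2⌉, which lowers the logarithm by one; it makes labels of ⌈log₂ n⌉
-- bits suffice for the nodes.
n≤2^⌈log₂n⌉ : ∀ n → n ≤ 2 ℕ.^ ⌈log₂ n ⌉
n≤2^⌈log₂n⌉ = <-rec Bounded step
  where
  open ℕ.≤-Reasoning
  Bounded : ℕ → Set
  Bounded n = n ≤ 2 ℕ.^ ⌈log₂ n ⌉
  step : ∀ n → (∀ {m} → m ℕ.< n → Bounded m) → Bounded n
  step 0               _   = z≤n
  step 1               _   = s≤s z≤n
  step m@(suc (suc n)) rec = begin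
    m                            ≡⟨ ℕ.⌊n/2⌋+⌈n/2⌉≡n m ⟨
    ℕ.⌊ m /2⌋ ℕ.+ ℕ.⌈ m /2⌉      ≤⟨ ℕ.+-monoˡ-≤ ℕ.⌈ m /2⌉ (ℕ.⌊n/2⌋≤⌈n/2⌉ m) ⟩
    ℕ.⌈ m /2⌉ ℕ.+ ℕ.⌈ m /2⌉      ≤⟨ ℕ.+-mono-≤ half≤ half≤ ⟩
    2^ℓ ℕ.+ 2^ℓ                  ≡⟨ cong (2^ℓ ℕ.+_) (ℕ.+-identityʳ 2^ℓ) ⟨
    2 ℕ.^ ⌈log₂ m ⌉              ∎
    where
    2^ℓ = 2 ℕ.^ (⌈log₂ m ⌉ ℕ.∸ 1)
    half≤ : ℕ.⌈ m /2⌉ ≤ 2^ℓ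
    half≤ = subst (λ e → ℕ.⌈ m /2⌉ ≤ 2 ℕ.^ e) (⌈log₂⌈n/2⌉⌉≡⌈log₂n⌉∸1 m) (rec (ℕ.⌈n/2⌉<n n))

-- The tower offers only powers of two as widths; rounding a desired width up to one at most doubles
-- it.
power-of-two-between : ∀ m → 1 ≤ m → ∃[ k ] m ≤ 2 ℕ.^ k × 2 ℕ.^ k ≤ 2 * m
power-of-two-between (suc zero)    _ = 0 , s≤s z≤n , s≤s z≤n
power-of-two-between (suc (suc m)) _ with power-of-two-between (suc m) (s≤s z≤n)
... | k , lower , upper with suc (suc m) ℕ.≤? 2 ℕ.^ k
...   | yes m<2^k = k , m<2^k , ℕ.≤-trans upper (ℕ.*-monoʳ-≤ 2 (ℕ.n≤1+n (suc m)))
...   | no m≮2^k  = suc k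
                  , ℕ.≤-trans (ℕ.+-mono-≤ (ℕ.m^n>0 2 k) lower) (ℕ.≤-reflexive (cong (2 ℕ.^ k ℕ.+_) (sym (ℕ.+-identityʳ _))))
                  , ℕ.*-monoʳ-≤ 2 (ℕ.≤-trans (ℕ.≤-pred (ℕ.≰⇒> m≮2^k)) (ℕ.n≤1+n (suc m)))

bits : ∀ ℓ → Fin (2 ℕ.^ ℓ) → Vec Bool ℓ
bits zero    _ = []
bits (suc ℓ) i = Inverse.to 2↔Bool (quotient (2 ℕ.^ ℓ) i) ∷ bits ℓ (remainder {2} (2 ℕ.^ ℓ) i)

unbits : ∀ ℓ → Vec Bool ℓ → Fin (2 ℕ.^ ℓ)
unbits zero    []       = zero
unbits (suc ℓ) (b ∷ bs) = combine (Inverse.from 2↔Bool b) (unbits ℓ bs)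

unbits-bits : ∀ ℓ i → unbits ℓ (bits ℓ i) ≡ i
unbits-bits zero    zero = refl
unbits-bits (suc ℓ) i    = trans
  (cong₂ combine (Inverse.strictlyInverseʳ 2↔Bool (quotient (2 ℕ.^ ℓ) i)) (unbits-bits ℓ (remainder {2} (2 ℕ.^ ℓ) i)))
  (combine-remQuot {2} (2 ℕ.^ ℓ) i)

bits-injective : ∀ ℓ {i j} → bits ℓ i ≡ bits ℓ j → i ≡ j
bits-injective ℓ {i} {j} eq = trans (sym (unbits-bits ℓ i)) (trans (cong (unbits ℓ) eq) (unbits-bits ℓ j))

module Points (F : BinaryField) {n ℓ : ℕ} (n≤2^ℓ : n ≤ 2 ℕ.^ ℓ) (fits : suc (ℓ ℕ.+ ℓ) ≤ BinaryField.width F) where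
  open BinaryField F

  index : Fin n → Vec Bool ℓ
  index u = bits ℓ (inject≤ u n≤2^ℓ)

  index-injective : Injective _≡_ _≡_ index
  index-injective eq = inject≤-injective n≤2^ℓ n≤2^ℓ _ _ (bits-injective ℓ eq)

  point : Vec Bool (suc (ℓ ℕ.+ ℓ)) → Carrier
  point = decode ∘ padRight fits false

  point-injective : Injective _≡_ _≡_ point
  point-injective {xs} {ys} eq = begin
    xs                                         ≡⟨ recover xs ⟨
    truncate fits (encode (point xs))          ≡⟨ cong (truncate fits ∘ encode) eq ⟩
    truncate fits (encode (point ys))          ≡⟨ recover ys ⟩
    ys                                         ∎
    where
    open ≡-Reasoning
    recover : ∀ xs → truncate fits (encode (point xs)) ≡ xs
    recover xs = trans (cong (truncate fits) (encode-decode _)) (Vec.truncate-padRight fits false xs)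

  -- The leading bit separates the points of `α` from those of `β`, and two labels name an ordered
  -- pair. `β` repeats its label to reach the same length 1 + 2ℓ.
  α : Fin n × Fin n → Carrier
  α (u , v) = point (true ∷ index u ++ index v)

  β : Fin n → Carrier
  β w = point (false ∷ index w ++ index w)

  α-injective : Injective _≡_ _≡_ α
  α-injective eq = let u≡ , v≡ = Vec.++-injective (index _) (index _) (Vec.∷-injectiveʳ (point-injective eq))
                   in cong₂ _,_ (index-injective u≡) (index-injective v≡)

  β-injective : Injective _≡_ _≡_ β
  β-injective eq = index-injective (Vec.++-injectiveˡ (index _) (index _) (Vec.∷-injectiveʳ (point-injective eq)))

  α≢β : ∀ p w → α p ≢ β w
  α≢β p w eq with Vec.∷-injectiveˡ (point-injective eq)
  ... | ()

-- The goal is 12q < n. For q ≥ 1 the thirteenth multiple of q pays for strictness; for q = 0 the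
-- hypothesis 1 ≤ n does.
decoding-bound : ∀ {q n} → 1 ≤ n → q * 13 ≤ n →
  suc ((q * 2 ℕ.+ q * 2) ℕ.+ ((q * 2 ℕ.+ q * 2) ℕ.+ (q * 2 ℕ.+ q * 2))) ≤ n
decoding-bound {zero}      1≤n _     = 1≤n
decoding-bound {q@(suc p)} _   13q≤n = ℕ.≤-trans (ℕ.≤-trans
  (ℕ.≤-reflexive (cong suc (solve 1 (λ q → (q :* con 2 :+ q :* con 2) :+ ((q :* con 2 :+ q :* con 2) :+ (q :* con 2 :+ q :* con 2))
                                          := q :* con 12) refl q)))
  (ℕ.≤-trans (ℕ.+-monoˡ-≤ (q * 12) (s≤s (z≤n {p})))
    (ℕ.≤-reflexive (solve 1 (λ q → q :+ q :* con 12 := q :* con 13) refl q)))) 13q≤n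
  where open ℕSolver.+-*-Solver

n/13-isΘn : IsΘn (_/ 13)
-- From n = 13 on the quotient is positive, so the remainder is at most 13 (n / 13) and n at most
-- twice that.
n/13-isΘn = 26 , 1 , 13 , λ n 13≤n →
  (begin
    n                        ≡⟨ m≡m%n+[m/n]*n n 13 ⟩
    n % 13 ℕ.+ n / 13 * 13   ≤⟨ ℕ.+-monoˡ-≤ _ (ℕ.<⇒≤ (m%n<n n 13)) ⟩
    13 ℕ.+ n / 13 * 13       ≤⟨ ℕ.+-monoˡ-≤ _ (ℕ.*-monoˡ-≤ 13 (m≥n⇒m/n>0 13≤n)) ⟩
    n / 13 * 13 ℕ.+ n / 13 * 13 ≡⟨ solve 1 (λ q → q :* con 13 :+ q :* con 13 := con 26 :* q) refl (n / 13) ⟩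
    26 * (n / 13)            ∎) ,
  ℕ.≤-trans (m/n≤m n 13) (ℕ.≤-reflexive (sym (ℕ.*-identityˡ n)))
  where
  open ℕ.≤-Reasoning
  open ℕSolver.+-*-Solver

-- Parameters of the compiled algorithm

CompilesTo : (b b′ c n : ℕ) .{{_ : NonZero n}} → Set₁
CompilesTo b b′ c n = (I O : Set) (A : Algorithm n (b * ⌈log₂ n ⌉) I O) →
  Σ (Algorithm n (b′ * ⌈log₂ n ⌉) I O) λ A′ →
    Algorithm.rounds A′ ≤ 3 * Algorithm.rounds A * polylog 0 n × ResilientlyEquivalent (n / 13) (1/ n ^ c) A A′

-- For n ≤ 1 messages are empty, so that no field element fits, but no edge is
-- ever controlled either.
compile-trivial : ∀ b b′ c n .{{_ : NonZero n}} → ⌈log₂ n ⌉ ≡ 0 → n / 13 ≡ 0 → CompilesTo b b′ c n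
compile-trivial b b′ c n ℓ≡0 f≡0 I O A = subst Target same-width
    ( A
    , ℕ.≤-trans (ℕ.m≤n*m rounds 3) (ℕ.≤-reflexive (sym (ℕ.*-identityʳ (3 * rounds))))
    , subst (λ f → ResilientlyEquivalent f (1/ n ^ c) A A) (sym f≡0) (resilient-0 A (0≤1/n^c n c)))
  where
  open Algorithm A using (rounds)
  Target : ℕ → Set₁
  Target w = Σ (Algorithm n w I O) λ A′ →
    Algorithm.rounds A′ ≤ 3 * rounds * polylog 0 n × ResilientlyEquivalent (n / 13) (1/ n ^ c) A A′
  same-width : b * ⌈log₂ n ⌉ ≡ b′ * ⌈log₂ n ⌉
  same-width rewrite ℓ≡0 = trans (ℕ.*-zeroʳ b) (sym (ℕ.*-zeroʳ b′))

-- A field element must hold a message of bℓ bits and also a point of 1 + 2ℓ ≤ 3ℓ bits; width (b +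
-- 3)ℓ is enough for either. Rounding up to a power of two gives the factor 2 in the new message
-- width.
module Coded (b n k : ℕ) (1≤ℓ : 1 ≤ ⌈log₂ n ⌉)
  (lower : (b ℕ.+ 3) * ⌈log₂ n ⌉ ≤ 2 ℕ.^ k) (upper : 2 ℕ.^ k ≤ 2 * ((b ℕ.+ 3) * ⌈log₂ n ⌉))
  where

  ℓ : ℕ
  ℓ = ⌈log₂ n ⌉

  F : BinaryField
  F = binaryTower k

  fits-width : (b ℕ.+ 3) * ℓ ≤ BinaryField.width F
  fits-width = ℕ.≤-trans lower (ℕ.≤-reflexive (sym (width-binaryTower k)))

  labels-fit : suc (ℓ ℕ.+ ℓ) ≤ BinaryField.width F
  labels-fit = ℕ.≤-trans (ℕ.+-monoˡ-≤ (ℓ ℕ.+ ℓ) 1≤ℓ)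
    (ℕ.≤-trans (ℕ.≤-reflexive (cong (λ x → ℓ ℕ.+ (ℓ ℕ.+ x)) (sym (ℕ.+-identityʳ ℓ))))
      (ℕ.≤-trans (ℕ.*-monoˡ-≤ ℓ (ℕ.m≤n+m 3 b)) fits-width))

  messages-fit : b * ℓ ≤ BinaryField.width F
  messages-fit = ℕ.≤-trans (ℕ.*-monoˡ-≤ ℓ (ℕ.m≤m+n b 3)) fits-width

  symbols-fit : BinaryField.width F ≤ 2 * (b ℕ.+ 3) * ℓ
  symbols-fit = ℕ.≤-trans (ℕ.≤-reflexive (width-binaryTower k))
    (ℕ.≤-trans upper (ℕ.≤-reflexive (sym (ℕ.*-assoc 2 (b ℕ.+ 3) ℓ))))

  open Points F {n} {ℓ} (n≤2^⌈log₂n⌉ n) labels-fit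
  open Compiler F α β α-injective β-injective α≢β messages-fit symbols-fit public

compile-coded : ∀ b c n .{{_ : NonZero n}} → 1 ≤ ⌈log₂ n ⌉ → CompilesTo b (2 * (b ℕ.+ 3)) c n
compile-coded b c n 1≤ℓ I O A =
  let k , lower , upper = power-of-two-between ((b ℕ.+ 3) * ⌈log₂ n ⌉) (ℕ.*-mono-≤ (ℕ.≤-trans (s≤s z≤n) (ℕ.m≤n+m 3 b)) 1≤ℓ)
      open Coded b n k 1≤ℓ lower upper
  in compiled A (n / 13)
   , ℕ.≤-reflexive (trans (ℕ.*-comm (rounds A) 3) (sym (ℕ.*-identityʳ (3 * rounds A))))
   , compiled-resilient A (n / 13) (0≤1/n^c n c) (decoding-bound {n / 13} (ℕ.>-nonZero⁻¹ n) (m/n*n≤m n 13))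
  where open Algorithm using (rounds)

compile : ∀ b c n .{{_ : NonZero n}} → CompilesTo b (2 * (b ℕ.+ 3)) c n
compile b c 0               = compile-trivial b (2 * (b ℕ.+ 3)) c 0 refl refl
compile b c 1               = compile-trivial b (2 * (b ℕ.+ 3)) c 1 refl refl
-- From n = 2 on the logarithm computes to a successor.
compile b c n@(suc (suc _)) = compile-coded b c n (s≤s z≤n)

theorem1p6 : ∃[ f ] IsΘn f ×
    (∀ (b : ℕ) → ∃[ b′ ] ∀ (c : ℕ) → ∃[ C ] ∃[ k ]
    ∀ (n : ℕ) .{{_ : NonZero n}} (I O : Set) (A : Algorithm n (b * ⌈log₂ n ⌉) I O) →
    Σ (Algorithm n (b′ * ⌈log₂ n ⌉) I O) λ A′ →
    (Algorithm.rounds A′ ≤ C * Algorithm.rounds A * polylog k n) ×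
    ResilientlyEquivalent (f n) (1/ n ^ c) A A′)
-- The overhead is exactly three rounds per round, so the polylogarithmic factor has exponent 0. As
-- the simulation never fails, the constants do not depend on c.
theorem1p6 = (_/ 13) , n/13-isΘn , λ b → 2 * (b ℕ.+ 3) , λ c → 3 , 0 , λ n → compile b c n
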